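{- For a tree $T$, $\lfloor \mathrm{sp}\rfloor(T)=|V(T)|-\mathrm{diam}(T)-1$.
   Context: All graphs are finite, have at least one vertex, have no loops, and may have multiple (parallel) edges. $\mathrm{diam}$ denotes the diameter (maximum distance between two vertices, distance measured in number of edges). A unique shortest path is a shortest $u$–$v$ path $P$ such that every $u$–$v$ path with the same number of vertices is identical to $P$, where two paths with different edge sequences are different even if their vertex sequences agree; a single vertex is a unique shortest path. The parade number $\mathrm{usp}(G)$ is the largest number of vertices of a unique shortest path in $G$. The spectator number is $\mathrm{sp}(G)=|V(G)|-\mathrm{usp}(G)$. A minor of $H$ is any graph obtained from $H$ by a sequence of: deleting an isolated vertex, deleting an edge, contracting an edge that has no edge parallel to it. The spectator floor $\lfloor \mathrm{sp}\rfloor(G)$ is the minimum of $\mathrm{sp}(H)$ over all graphs $H$ of which $G$ is a minor. -}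

module Defs where

open import Data.Nat using (ℕ; _∸_; _≤_)
open import Data.Fin using (Fin)
open import Data.List using (List; []; _∷_; length)
open import Data.List.Membership.Propositional using (_∉_)
open import Data.List.Relation.Unary.Unique.Propositional using (Unique)
open import Data.Product using (Σ; ∃-syntax; _×_; _,_; proj₁; proj₂)
open import Data.Sum using (_⊎_)
open import Function.Bundles using (_⇔_; _↔_; Inverse)
open import Function.Definitions using (Injective; Surjective)
open import Relation.Binary.Construct.Closure.ReflexiveTransitive using (Star)
open import Relation.Binary.PropositionalEquality using (_≡_; _≢_)
open import Relation.Nullary using (¬_)

-- Finite, nonempty, loopless multigraphs.  Edges are undirected: the order of
-- the pair `ends e` carries no meaning and is forgotten by `Joins` below.
record Graph : Set where
  field
    order    : ℕ
    size     : ℕ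
    nonempty : 1 ≤ order
    ends     : Fin size → Fin order × Fin order
    loopless : ∀ e → proj₁ (ends e) ≢ proj₂ (ends e)

open Graph public

V : Graph → Set
V G = Fin (order G)

E : Graph → Set
E G = Fin (size G)

Joins : (G : Graph) → E G → V G → V G → Set
Joins G e x y = ends G e ≡ (x , y) ⊎ ends G e ≡ (y , x)

data Walk (G : Graph) : V G → V G → Set where
  stop : (u : V G) → Walk G u u
  step : (u : V G) {v w : V G} (e : E G) → Joins G e u v → Walk G v w → Walk G u w

vertices : ∀ {G u v} → Walk G u v → List (V G)
vertices (stop u)       = u ∷ []
vertices (step u _ _ W) = u ∷ vertices W

edges : ∀ {G u v} → Walk G u v → List (E G)
edges (stop _)       = []
edges (step _ e _ W) = e ∷ edges W

record Path (G : Graph) (u v : V G) : Set where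
  field
    walk   : Walk G u v
    simple : Unique (vertices walk)

open Path public

pathVertices : ∀ {G u v} → Path G u v → List (V G)
pathVertices P = vertices (walk P)

pathEdges : ∀ {G u v} → Path G u v → List (E G)
pathEdges P = edges (walk P)

#vertices : ∀ {G u v} → Path G u v → ℕ
#vertices P = length (pathVertices P)

#edges : ∀ {G u v} → Path G u v → ℕ
#edges P = length (pathEdges P)

IsShortest : ∀ {G u v} → Path G u v → Set
IsShortest {G} {u} {v} P = ∀ (Q : Path G u v) → #edges P ≤ #edges Q

-- Paths are identified with their edge sequences; together with the common
-- starting vertex u these determine the vertex sequences.
IsUniqueShortest : ∀ {G u v} → Path G u v → Set
IsUniqueShortest {G} {u} {v} P =
  IsShortest P ×
  (∀ (Q : Path G u v) → #vertices Q ≡ #vertices P → pathEdges Q ≡ pathEdges P)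

IsDistance : (G : Graph) → V G → V G → ℕ → Set
IsDistance G u v d = ∃[ P ] IsShortest {G} {u} {v} P × #edges P ≡ d

-- A disconnected graph has no diameter in this sense.
IsDiameter : Graph → ℕ → Set
IsDiameter G d =
  (∃[ u ] ∃[ v ] IsDistance G u v d) ×
  (∀ u v → ∃[ d′ ] IsDistance G u v d′ × d′ ≤ d)

IsParadeNumber : Graph → ℕ → Set
IsParadeNumber G k =
  (∃[ u ] ∃[ v ] Σ (Path G u v) λ P → IsUniqueShortest P × #vertices P ≡ k) ×
  (∀ u v (P : Path G u v) → IsUniqueShortest P → #vertices P ≤ k)

-- The vertices of a path are distinct, so the subtraction never truncates.
IsSpectatorNumber : Graph → ℕ → Set
IsSpectatorNumber G s = ∃[ k ] IsParadeNumber G k × s ≡ order G ∸ k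

Connected : Graph → Set
Connected G = ∀ u v → Path G u v

-- A path closed up by an edge not on it.  Two parallel edges form a cycle.
record Cycle (G : Graph) : Set where
  field
    {u v}    : V G
    path     : Path G u v
    closing  : E G
    closes   : Joins G closing v u
    distinct : closing ∉ pathEdges path

IsTree : Graph → Set
IsTree G = Connected G × ¬ Cycle G

record _≅_ (G H : Graph) : Set where
  field
    onV   : V G ↔ V H
    onE   : E G ↔ E H
    joins : ∀ e x y → Joins G e x y →
            Joins H (Inverse.to onE e) (Inverse.to onV x) (Inverse.to onV y)

-- f is a bijection from A onto B ∖ {b}.
OntoAllBut : {A B : Set} → (A → B) → B → Set
OntoAllBut f b = Injective _≡_ _≡_ f × (∀ y → (∃[ x ] f x ≡ y) ⇔ y ≢ b)

-- In the next three records G is the result of the operation on H, up to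
-- isomorphism.
record VertexDeletion (H G : Graph) : Set where
  field
    deleted  : V H
    isolated : ∀ e y → ¬ Joins H e deleted y
    onV      : V G → V H
    onV-but  : OntoAllBut onV deleted
    onE      : E G ↔ E H
    joins    : ∀ e x y → Joins G e x y → Joins H (Inverse.to onE e) (onV x) (onV y)

record EdgeDeletion (H G : Graph) : Set where
  field
    deleted : E H
    onV     : V G ↔ V H
    onE     : E G → E H
    onE-but : OntoAllBut onE deleted
    joins   : ∀ e x y → Joins G e x y →
              Joins H (onE e) (Inverse.to onV x) (Inverse.to onV y)

-- The vertex map goes from H to G and identifies exactly the two ends of the
-- contracted edge.
record EdgeContraction (H G : Graph) : Set where
  field
    contracted  : E H
    no-parallel : ∀ e x y → Joins H contracted x y → Joins H e x y → e ≡ contracted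
    onV         : V H → V G
    onV-surj    : Surjective _≡_ _≡_ onV
    onV-kernel  : ∀ x y → onV x ≡ onV y ⇔ (x ≡ y ⊎ Joins H contracted x y)
    onE         : E G → E H
    onE-but     : OntoAllBut onE contracted
    joins       : ∀ e x y → Joins H (onE e) x y → Joins G e (onV x) (onV y)

MinorStep : Graph → Graph → Set
MinorStep H G = VertexDeletion H G ⊎ EdgeDeletion H G ⊎ EdgeContraction H G

_IsMinorOf_ : Graph → Graph → Set
G IsMinorOf H = ∃[ K ] Star MinorStep H K × K ≅ G

IsSpectatorFloor : Graph → ℕ → Set
IsSpectatorFloor G s =
  (∃[ H ] G IsMinorOf H × IsSpectatorNumber H s) ×
  (∀ H s′ → G IsMinorOf H → IsSpectatorNumber H s′ → s ≤ s′)

{-# OPTIONS --safe #-}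
-- The value is attained by T itself, since paths in a tree are determined by
-- their ends.
--
-- For the lower bound, consider a set X of vertices of a graph, any two of which
-- are joined by a path of length at most D inside X, and the number |X| − D.
-- For T this number is |V(T)| − diam(T), and it can be pulled back without loss
-- along every minor step: undoing a contraction lengthens the paths by at most
-- one, and only if the preimage of X has one more vertex than X.  Finally, if H
-- carries such an X, a shortest path P of H meets X in at most D + 1 vertices,
-- all within distance D of the first of them, so |X| − D − 1 ≤ |V(H) ∖ P|.
module Submission where

open import Data.Fin using (Fin; zero; suc)
open import Data.Fin.Properties using (injective⇒≤; _≟_)
open import Data.List using (List; []; _∷_; _++_; length; map; filter; take; lookup; allFin)
open import Data.List.Membership.Propositional using (_∈_; _∉_)
open import Data.List.Membership.Propositional.Properties
  using (∈-lookup; ∈-map⁺; ∈-map⁻; ∈-++⁺ˡ; ∈-++⁺ʳ; ∈-++⁻; ∈-filter⁺; ∈-filter⁻; ∈-allFin)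
open import Data.List.Membership.Setoid.Properties using (index-injective)
open import Data.List.Properties using (length-++; length-map; length-take; length-tabulate)
open import Data.List.Relation.Binary.Subset.Propositional using (_⊆_)
open import Data.List.Relation.Binary.Subset.Propositional.Properties using (∷⁺ʳ)
open import Data.List.Relation.Unary.All using ([]) renaming (lookup to All-lookup)
open import Data.List.Relation.Unary.All.Properties using (¬Any⇒All¬; All¬⇒¬Any)
open import Data.List.Relation.Unary.Any using (here; there; index)
open import Data.List.Relation.Unary.AllPairs using ([]; _∷_)
open import Data.List.Relation.Unary.Unique.Propositional using (Unique)
import Data.List.Relation.Unary.Unique.Propositional.Properties as Unique
open import Data.Nat using (ℕ; zero; suc; _+_; _∸_; _≤_; z≤n; s≤s)
open import Data.Nat.Properties using
  ( ≤-refl; ≤-trans; ≤-reflexive; ≤-pred; module ≤-Reasoning; m≤n⇒m≤1+n; m⊓n≤m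
  ; +-assoc; +-comm; +-suc; +-monoˡ-≤; +-monoʳ-≤; +-cancelʳ-≤
  ; m≤n+o⇒m∸n≤o; m∸n+n≡m; ∸-+-assoc)
open import Data.Nat.Tactic.RingSolver using (solve-∀)
open import Data.Product using (Σ; ∃-syntax; _×_; _,_; proj₁; proj₂)
open import Data.Sum using (_⊎_; inj₁; inj₂; swap)
open import Function using (id; _∘_)
open import Function.Bundles using (_↔_; Inverse; Equivalence)
open import Function.Definitions using (Injective)
open import Function.Properties.Inverse using (↔-refl)
open import Relation.Binary.Construct.Closure.ReflexiveTransitive using (Star; ε; _◅_)
open import Relation.Binary.PropositionalEquality
  using (_≡_; _≢_; refl; sym; trans; cong; cong₂; subst; subst₂; setoid)
open import Relation.Nullary using (yes; no; ¬_; ¬?; contradiction)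
open import Defs

-- Counting with lists without repetitions.

module _ {A : Set} where

  lookup-injective : ∀ {xs : List A} → Unique xs → Injective _≡_ _≡_ (lookup xs)
  lookup-injective {_ ∷ _}  _        {zero}  {zero}  _  = refl
  lookup-injective {_ ∷ xs} (x∉ ∷ _) {zero}  {suc j} eq = contradiction eq (All-lookup x∉ (∈-lookup j))
  lookup-injective {_ ∷ xs} (x∉ ∷ _) {suc i} {zero}  eq = contradiction (sym eq) (All-lookup x∉ (∈-lookup i))
  lookup-injective {_ ∷ _}  (_ ∷ u)  {suc i} {suc j} eq = cong suc (lookup-injective u eq)

  -- Sending each position in `xs` to the position of its entry in `ys` is injective.
  unique-⊆⇒length≤ : ∀ {xs ys : List A} → Unique xs → xs ⊆ ys → length xs ≤ length ys
  unique-⊆⇒length≤ {xs} u sub = injective⇒≤ λ {i} {j} eq →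
    lookup-injective u (index-injective (setoid A) (sub (∈-lookup i)) (sub (∈-lookup j)) eq)

  take-⊆ : ∀ {m n} (xs : List A) → m ≤ n → take m xs ⊆ take n xs
  take-⊆ (_ ∷ _)  (s≤s _) (here eq) = here eq
  take-⊆ (_ ∷ xs) (s≤s p) (there q) = there (take-⊆ xs p q)

  unique-∷ : ∀ {x} {xs : List A} → x ∉ xs → Unique xs → Unique (x ∷ xs)
  unique-∷ x∉ u = ¬Any⇒All¬ _ x∉ ∷ u

  unique-head : ∀ {x} {xs : List A} → Unique (x ∷ xs) → x ∉ xs
  unique-head (x∉ ∷ _) = All¬⇒¬Any x∉

  unique-tail : ∀ {x} {xs : List A} → Unique (x ∷ xs) → Unique xs
  unique-tail (_ ∷ u) = u

length-allFin : ∀ n → length (allFin n) ≡ n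
length-allFin n = length-tabulate id

unique⇒length≤ : ∀ {n} {xs : List (Fin n)} → Unique xs → length xs ≤ n
unique⇒length≤ {n} {xs} u = subst (length xs ≤_) (length-allFin n) (unique-⊆⇒length≤ u λ {x} _ → ∈-allFin x)

module _ {n : ℕ} where
  open import Data.List.Membership.DecPropositional (_≟_ {n}) using (_∈?_) public

-- Walks and paths in a multigraph, and uniqueness of paths without cycles.

module _ {G : Graph} where

  len : ∀ {u v} → Walk G u v → ℕ
  len W = length (edges W)

  length-vertices : ∀ {u v} (W : Walk G u v) → length (vertices W) ≡ suc (len W)
  length-vertices (stop _)       = refl
  length-vertices (step _ _ _ W) = cong suc (length-vertices W)

  first-∈ : ∀ {u v} (W : Walk G u v) → u ∈ vertices W
  first-∈ (stop _)       = here refl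
  first-∈ (step _ _ _ _) = here refl

  last-∈ : ∀ {u v} (W : Walk G u v) → v ∈ vertices W
  last-∈ (stop _)       = here refl
  last-∈ (step _ _ _ W) = there (last-∈ W)

  joins-match : ∀ {e x y a b} → Joins G e x y → Joins G e a b →
                (x ≡ a × y ≡ b) ⊎ (x ≡ b × y ≡ a)
  joins-match (inj₁ p) (inj₁ q) with refl ← trans (sym p) q = inj₁ (refl , refl)
  joins-match (inj₁ p) (inj₂ q) with refl ← trans (sym p) q = inj₂ (refl , refl)
  joins-match (inj₂ p) (inj₁ q) with refl ← trans (sym p) q = inj₂ (refl , refl)
  joins-match (inj₂ p) (inj₂ q) with refl ← trans (sym p) q = inj₁ (refl , refl)

  joins-≢ : ∀ {e x y} → Joins G e x y → x ≢ y
  joins-≢ {e} (inj₁ p) refl = loopless G e (trans (cong proj₁ p) (cong proj₂ (sym p)))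
  joins-≢ {e} (inj₂ p) refl = loopless G e (trans (cong proj₁ p) (cong proj₂ (sym p)))

  joins-functional : ∀ {e x y z} → Joins G e x y → Joins G e x z → y ≡ z
  joins-functional {e} j k with joins-match j k
  ... | inj₁ (_ , y≡z)   = y≡z
  ... | inj₂ (x≡z , y≡x) = trans y≡x x≡z

  edge-end-∈ : ∀ {u v e x y} (W : Walk G u v) → e ∈ edges W → Joins G e x y → x ∈ vertices W
  edge-end-∈ (step _ _ j W) (here refl) k with joins-match k j
  ... | inj₁ (refl , _) = here refl
  ... | inj₂ (refl , _) = there (first-∈ W)
  edge-end-∈ (step _ _ _ W) (there e∈) k = there (edge-end-∈ W e∈ k)

  infixr 5 _⊕_
  _⊕_ : ∀ {u v w} → Walk G u v → Walk G v w → Walk G u w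
  stop _       ⊕ W′ = W′
  step u e j W ⊕ W′ = step u e j (W ⊕ W′)

  len-⊕ : ∀ {u v w} (W : Walk G u v) (W′ : Walk G v w) → len (W ⊕ W′) ≡ len W + len W′
  len-⊕ (stop _)       W′ = refl
  len-⊕ (step _ _ _ W) W′ = cong suc (len-⊕ W W′)

  ∈-edges-⊕ : ∀ {u v w e} (W : Walk G u v) {W′ : Walk G v w} →
              e ∈ edges (W ⊕ W′) → e ∈ edges W ⊎ e ∈ edges W′
  ∈-edges-⊕ (stop _)       e∈         = inj₂ e∈
  ∈-edges-⊕ (step _ _ _ W) (here eq)  = inj₁ (here eq)
  ∈-edges-⊕ (step _ _ _ W) (there e∈) with ∈-edges-⊕ W e∈
  ... | inj₁ p = inj₁ (there p)
  ... | inj₂ p = inj₂ p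

  reverse : ∀ {u v} → Walk G u v → Walk G v u
  reverse (stop u)       = stop u
  reverse (step u e j W) = reverse W ⊕ step _ e (swap j) (stop u)

  edges-reverse-⊆ : ∀ {u v} (W : Walk G u v) → edges (reverse W) ⊆ edges W
  edges-reverse-⊆ (step _ _ _ W) e∈ with ∈-edges-⊕ (reverse W) e∈
  ... | inj₁ p           = there (edges-reverse-⊆ W p)
  ... | inj₂ (here refl) = here refl

  -- Collects what shortening a walk preserves: the length serves distances, the vertices serve
  -- staying inside a given set, the edges serve avoiding the closing edge of a cycle.
  record Within {x y u v : V G} (W′ : Walk G x y) (W : Walk G u v) : Set where
    field
      len-≤      : len W′ ≤ len W
      vertices-⊆ : vertices W′ ⊆ vertices W
      edges-⊆    : edges W′ ⊆ edges W
  open Within public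

  within-step : ∀ {x y u v w e} {j : Joins G e u v} {W′ : Walk G x y} {W : Walk G v w} →
                Within W′ W → Within W′ (step u e j W)
  within-step I = record
    { len-≤      = m≤n⇒m≤1+n (len-≤ I)
    ; vertices-⊆ = there ∘ vertices-⊆ I
    ; edges-⊆    = there ∘ edges-⊆ I
    }

  within-refl : ∀ {u v} (W : Walk G u v) → Within W W
  within-refl W = record { len-≤ = ≤-refl ; vertices-⊆ = id ; edges-⊆ = id }

  suffix : ∀ {u v x} (W : Walk G u v) → Unique (vertices W) → x ∈ vertices W →
           Σ (Path G x v) λ P → Within (walk P) W
  suffix W@(stop _)       u (here refl) = record { walk = W ; simple = u } , within-refl W
  suffix W@(step _ _ _ _) u (here refl) = record { walk = W ; simple = u } , within-refl W
  suffix (step _ _ _ W) (_ ∷ u) (there x∈) with P , I ← suffix W u x∈ = P , within-step I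

  -- Loops are erased from the far end: the tail is made simple first, and if it returns to `u`, its
  -- part from `u` on replaces the whole walk.
  walk⇒path : ∀ {u v} (W : Walk G u v) → Σ (Path G u v) λ P → Within (walk P) W
  walk⇒path W@(stop _) = record { walk = W ; simple = [] ∷ [] } , within-refl W
  walk⇒path (step u e j W) with walk⇒path W
  ... | P , I with u ∈? pathVertices P
  ...   | yes u∈ with Q , J ← suffix (walk P) (simple P) u∈ = Q , within-step record
          { len-≤      = ≤-trans (len-≤ J) (len-≤ I)
          ; vertices-⊆ = vertices-⊆ I ∘ vertices-⊆ J
          ; edges-⊆    = edges-⊆ I ∘ edges-⊆ J
          }
  ...   | no u∉ = record { walk = step u e j (walk P) ; simple = unique-∷ u∉ (simple P) } , record
          { len-≤      = s≤s (len-≤ I)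
          ; vertices-⊆ = ∷⁺ʳ u (vertices-⊆ I)
          ; edges-⊆    = ∷⁺ʳ e (edges-⊆ I)
          }

  -- Where two paths from u first diverge, along edges e ≠ f, their remainders
  -- avoid u and hence e, so together with f they connect the ends of e without e.
  acyclic⇒edges-unique : ¬ Cycle G → ∀ {u v} (W W′ : Walk G u v) →
                         Unique (vertices W) → Unique (vertices W′) → edges W ≡ edges W′
  acyclic⇒edges-unique acyclic (stop _) (stop _) _ _ = refl
  acyclic⇒edges-unique acyclic (stop _) (step _ _ _ W′) _ u′ = contradiction (last-∈ W′) (unique-head u′)
  acyclic⇒edges-unique acyclic (step _ _ _ W) (stop _) u _ = contradiction (last-∈ W) (unique-head u)
  acyclic⇒edges-unique acyclic (step x e j W) (step _ f k W′) u u′ with e ≟ f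
  ... | yes refl with refl ← joins-functional j k =
    cong (e ∷_) (acyclic⇒edges-unique acyclic W W′ (unique-tail u) (unique-tail u′))
  ... | no e≢f = contradiction cycle acyclic
    where
    detour = W ⊕ reverse W′ ⊕ step _ f (swap k) (stop x)

    e∉detour : e ∉ edges detour
    e∉detour e∈ with ∈-edges-⊕ W e∈
    ... | inj₁ p = unique-head u (edge-end-∈ W p j)
    ... | inj₂ p with ∈-edges-⊕ (reverse W′) p
    ...   | inj₁ q          = unique-head u′ (edge-end-∈ W′ (edges-reverse-⊆ W′ q) j)
    ...   | inj₂ (here e≡f) = e≢f e≡f

    cycle : Cycle G
    cycle with P , I ← walk⇒path detour = record
      { path = P ; closing = e ; closes = j ; distinct = e∉detour ∘ edges-⊆ I }

  -- Minimal walks and linked sets.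

  split : ∀ {u v x} (W : Walk G u v) → x ∈ vertices W →
          Σ (Walk G u x) λ W₁ → Σ (Walk G x v) λ W₂ →
            len W ≡ len W₁ + len W₂ × x ∈ take (suc (len W₁)) (vertices W)
  split W@(stop _)       (here refl) = stop _ , W , refl , here refl
  split W@(step _ _ _ _) (here refl) = stop _ , W , refl , here refl
  split (step u e j W) (there x∈) with W₁ , W₂ , eq , x∈′ ← split W x∈ =
    step u e j W₁ , W₂ , cong suc eq , there x∈′

  -- The comparison is with all walks, so that a concatenation can serve as a competitor without
  -- first being made simple.
  Minimal : ∀ {u v} → Walk G u v → Set
  Minimal {u} {v} W = ∀ (W′ : Walk G u v) → len W ≤ len W′

  minimal-tail : ∀ {u v w e} {j : Joins G e u v} {W : Walk G v w} →
                 Minimal (step u e j W) → Minimal W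
  minimal-tail {u} {e = e} {j} min W′ = ≤-pred (min (step u e j W′))

  shortest⇒minimal : ∀ {u v} {P : Path G u v} → IsShortest P → Minimal (walk P)
  shortest⇒minimal short W with Q , I ← walk⇒path W = ≤-trans (short Q) (len-≤ I)

  -- Since the paths stay inside `X`, they avoid a contracted vertex outside `X`, and their lifts
  -- stay inside the preimage of `X`.
  Linked : List (V G) → ℕ → Set
  Linked X D = ∀ {x y} → x ∈ X → y ∈ X →
    Σ (Path G x y) λ P → #edges P ≤ D × pathVertices P ⊆ X

  -- Follow `W` to its first vertex in `X`. All members of `X` on `W` come at or after it and at
  -- distance at most `D` from it, so they lie among the next `D + 1` vertices of `W`, counting that
  -- vertex itself; these form `L`.
  minimal-meets-linked : ∀ {X D} → Linked X D → ∀ {u v} (W : Walk G u v) → Minimal W →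
    ∃[ L ] length L ≤ suc D × (∀ {x} → x ∈ X → x ∈ vertices W → x ∈ L)
  minimal-meets-linked {X} {D} linked {u} {v} W min with u ∈? X
  ... | yes u∈ = take (suc D) (vertices W)
               , subst (_≤ suc D) (sym (length-take (suc D) (vertices W))) (m⊓n≤m _ _)
               , near
    where
    near : ∀ {x} → x ∈ X → x ∈ vertices W → x ∈ take (suc D) (vertices W)
    near x∈X x∈W with W₁ , W₂ , eq , x∈ ← split W x∈W | P , P≤D , _ ← linked u∈ x∈X =
      take-⊆ (vertices W) (s≤s (≤-trans (+-cancelʳ-≤ (len W₂) _ _ shortcut) P≤D)) x∈
      where
      -- Replacing the initial part `W₁` by the linking path cannot shorten the minimal walk.
      shortcut : len W₁ + len W₂ ≤ len (walk P) + len W₂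
      shortcut = subst₂ _≤_ eq (len-⊕ (walk P) W₂) (min (walk P ⊕ W₂))
  minimal-meets-linked linked (stop _) _ | no u∉ =
    [] , z≤n , λ { x∈ (here refl) → contradiction x∈ u∉ }
  minimal-meets-linked linked (step _ e j W) min | no u∉
    with L , L≤ , covers ← minimal-meets-linked linked W (minimal-tail {j = j} {W = W} min) =
    L , L≤ , λ { x∈ (here refl) → contradiction x∈ u∉ ; x∈ (there x∈W) → covers x∈ x∈W }

  -- At most `D + 1` members of `X` lie on `P`. The remaining members are disjoint from `P`, so
  -- together with the vertices of `P` they number at most `order G`.
  linked-bound : ∀ {X D} → Unique X → Linked X D → ∀ {u v} (P : Path G u v) → IsShortest P →
                 length X + #vertices P ≤ suc D + order G
  linked-bound {X} {D} uX linked P short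
    with L , L≤ , covers ← minimal-meets-linked linked (walk P) (shortest⇒minimal {P = P} short) = begin
    length X + #vertices P                  ≤⟨ +-monoˡ-≤ _ (unique-⊆⇒length≤ uX X⊆) ⟩
    length (L ++ rest) + #vertices P        ≡⟨ cong (_+ #vertices P) (length-++ L) ⟩
    length L + length rest + #vertices P    ≤⟨ +-monoˡ-≤ _ (+-monoˡ-≤ _ L≤) ⟩
    suc D + length rest + #vertices P       ≡⟨ +-assoc (suc D) _ _ ⟩
    suc D + (length rest + #vertices P)     ≡⟨ cong (suc D +_) (length-++ rest) ⟨
    suc D + length (rest ++ pathVertices P) ≤⟨ +-monoʳ-≤ (suc D) (unique⇒length≤ disjoint-union) ⟩
    suc D + order G                         ∎
    where
    open ≤-Reasoning
    off? = λ x → ¬? (x ∈? pathVertices P)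
    rest = filter off? X

    X⊆ : X ⊆ L ++ rest
    X⊆ {x} x∈ with x ∈? pathVertices P
    ... | yes x∈P = ∈-++⁺ˡ (covers x∈ x∈P)
    ... | no  x∉P = ∈-++⁺ʳ L (∈-filter⁺ off? x∈ x∉P)

    disjoint-union : Unique (rest ++ pathVertices P)
    disjoint-union = Unique.++⁺ (Unique.filter⁺ off? uX) (simple P)
      λ (x∈rest , x∈P) → proj₂ (∈-filter⁻ off? {xs = X} x∈rest) x∈P

-- n − d bounds |X| − D from below for some linked set X.
record Cluster (n d : ℕ) (G : Graph) : Set where
  field
    members : List (V G)
    unique  : Unique members
    radius  : ℕ
    linked  : Linked {G} members radius
    excess  : n + radius ≤ length members + d

-- Embeddings, the common form of an undone deletion and of an isomorphism.

record _↪_ (G H : Graph) : Set where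
  field
    onV           : V G → V H
    onV-injective : Injective _≡_ _≡_ onV
    onE           : E G → E H
    joins         : ∀ e x y → Joins G e x y → Joins H (onE e) (onV x) (onV y)

  map-walk : ∀ {u v} → Walk G u v → Walk H (onV u) (onV v)
  map-walk (stop u)       = stop (onV u)
  map-walk (step u e j W) = step (onV u) (onE e) (joins e _ _ j) (map-walk W)

  vertices-map-walk : ∀ {u v} (W : Walk G u v) → vertices (map-walk W) ≡ map onV (vertices W)
  vertices-map-walk (stop _)       = refl
  vertices-map-walk (step _ _ _ W) = cong (_ ∷_) (vertices-map-walk W)

  len-map-walk : ∀ {u v} (W : Walk G u v) → len (map-walk W) ≡ len W
  len-map-walk (stop _)       = refl
  len-map-walk (step _ _ _ W) = cong suc (len-map-walk W)

  map-cluster : ∀ {n d} → Cluster n d G → Cluster n d H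
  map-cluster {n} {d} C = record
    { members = map onV members
    ; unique  = Unique.map⁺ onV-injective unique
    ; radius  = radius
    ; linked  = linked′
    ; excess  = subst (λ l → n + radius ≤ l + d) (sym (length-map onV members)) excess
    }
    where
    open Cluster C

    linked′ : Linked {H} (map onV members) radius
    linked′ x∈ y∈ with x , x∈ , refl ← ∈-map⁻ onV x∈ | y , y∈ , refl ← ∈-map⁻ onV y∈
      with P , P≤ , P⊆ ← linked x∈ y∈ =
      record { walk = map-walk (walk P)
             ; simple = subst Unique (sym vs) (Unique.map⁺ onV-injective (simple P)) }
      , subst (_≤ radius) (sym (len-map-walk (walk P))) P≤
      , λ z∈ → let z′ , z′∈ , eq = ∈-map⁻ onV (subst (_ ∈_) vs z∈)
               in subst (_∈ map onV members) (sym eq) (∈-map⁺ onV (P⊆ z′∈))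
      where vs = vertices-map-walk (walk P)

vertexDeletion⇒↪ : ∀ {H G} → VertexDeletion H G → G ↪ H
vertexDeletion⇒↪ D = record
  { onV = onV ; onV-injective = proj₁ onV-but ; onE = Inverse.to onE ; joins = joins }
  where open VertexDeletion D

↔-injective : ∀ {A B : Set} (f : A ↔ B) → Injective _≡_ _≡_ (Inverse.to f)
↔-injective f {x} {y} eq = trans (sym (Inverse.strictlyInverseʳ f x)) (Inverse.inverseʳ f eq)

edgeDeletion⇒↪ : ∀ {H G} → EdgeDeletion H G → G ↪ H
edgeDeletion⇒↪ D = record
  { onV = Inverse.to onV ; onV-injective = ↔-injective onV ; onE = onE ; joins = joins }
  where open EdgeDeletion D

≅-refl : ∀ {G} → G ≅ G
≅-refl = record { onV = ↔-refl ; onE = ↔-refl ; joins = λ _ _ _ → id }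

≅⇒↪ : ∀ {G H} → G ≅ H → H ↪ G
≅⇒↪ {G} {H} I = record
  { onV           = from onV
  ; onV-injective = λ {x} {y} eq → trans (sym (inverseˡ onV refl)) (inverseˡ onV {x = y} eq)
  ; onE           = from onE
  ; joins         = joins′
  }
  where
  open _≅_ I
  open Inverse
  joins′ : ∀ e x y → Joins H e x y → Joins G (from onE e) (from onV x) (from onV y)
  joins′ e x y j
    -- An isomorphism states `joins` forwards only. It is applied to the stored ends of
    -- `from onE e`, whose images must then be `x` and `y` in some order.
    with joins-match {H} j (subst (λ f → Joins H f _ _) (inverseˡ onE refl) (joins (from onE e) _ _ (inj₁ refl)))
  ... | inj₁ (refl , refl) = inj₁ (cong₂ _,_ (sym (inverseʳ onV refl)) (sym (inverseʳ onV refl)))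
  ... | inj₂ (refl , refl) = inj₂ (cong₂ _,_ (sym (inverseʳ onV refl)) (sym (inverseʳ onV refl)))

-- Lifting walks through a contraction.

module _ {H G : Graph} (C : EdgeContraction H G) where
  open EdgeContraction C

  private
    p q : V H
    p = proj₁ (ends H contracted)
    q = proj₂ (ends H contracted)

    c : V G
    c = onV p

    p~q : Joins H contracted p q
    p~q = inj₁ refl

    onV-q : onV q ≡ c
    onV-q = sym (Equivalence.from (onV-kernel p q) (inj₂ p~q))

  contracted-end : ∀ {x y} → Joins H contracted x y → onV x ≡ c
  contracted-end j with joins-match {H} j p~q
  ... | inj₁ (refl , _) = refl
  ... | inj₂ (refl , _) = onV-q

  -- `joins` leads from `H` to `G`, so it is applied to the stored ends of `onE e`; their images are
  -- the ends of `e`, in one order or the other.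
  lift-edge : ∀ {e a b} → Joins G e a b →
              ∃[ x ] ∃[ y ] Joins H (onE e) x y × onV x ≡ a × onV y ≡ b
  lift-edge {e} j with joins-match {G} j (joins e _ _ (inj₁ refl))
  ... | inj₁ (eq₁ , eq₂) = _ , _ , inj₁ refl , sym eq₁ , sym eq₂
  ... | inj₂ (eq₁ , eq₂) = _ , _ , inj₂ refl , sym eq₁ , sym eq₂

  Over : ∀ {a b x y} → Walk G a b → Walk H x y → Set
  Over W W′ = ∀ {z} → z ∈ vertices W′ → onV z ∈ vertices W

  over-step : ∀ {u v w e x x′ y f} {j : Joins G e u v} {k : Joins H f x x′}
              (W : Walk G v w) (W′ : Walk H x′ y) →
              onV x ≡ u → Over W W′ → Over (step u e j W) (step x f k W′)
  over-step _ _ eq over (here refl) = here eq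
  over-step _ _ eq over (there z∈)  = there (over z∈)

  -- Away from `c` every vertex of `G` has a single preimage, so the lifted edges fit together end
  -- to end and no edge has to be inserted.
  lift-avoiding : ∀ {a b x y} (W : Walk G a b) → c ∉ vertices W → onV x ≡ a → onV y ≡ b →
                  Σ (Walk H x y) λ W′ → len W′ ≡ len W × Over W W′
  lift-avoiding {x = x} {y} (stop _) c∉ eqx eqy
    with Equivalence.to (onV-kernel x y) (trans eqx (sym eqy))
  ... | inj₁ refl = stop x , refl , λ { (here refl) → here eqx }
  ... | inj₂ j    = contradiction (here (trans (sym (contracted-end j)) eqx)) c∉
  lift-avoiding {x = x} (step _ e j W) c∉ eqx eqy
    with x₁ , x₂ , k , eq₁ , eq₂ ← lift-edge j
    with Equivalence.to (onV-kernel x x₁) (trans eqx (sym eq₁))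
  ... | inj₂ l    = contradiction (here (trans (sym (contracted-end l)) eqx)) c∉
  ... | inj₁ refl with W′ , eq , over ← lift-avoiding W (c∉ ∘ there) eq₂ eqy =
    step x (onE e) k W′ , cong suc eq , over-step {j = j} {k = k} W W′ eq₁ over

  -- A path visits the contracted vertex at most once.
  lift : ∀ {a b x y} (W : Walk G a b) → Unique (vertices W) → onV x ≡ a → onV y ≡ b →
         Σ (Walk H x y) λ W′ → len W′ ≤ suc (len W) × Over W W′
  lift {x = x} {y} (stop _) _ eqx eqy
    with Equivalence.to (onV-kernel x y) (trans eqx (sym eqy))
  ... | inj₁ refl = stop x , z≤n , λ { (here refl) → here eqx }
  ... | inj₂ j    = step x contracted j (stop y) , ≤-refl
                  , λ { (here refl) → here eqx ; (there (here refl)) → here eqy }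
  lift {x = x} (step _ e j W) u eqx eqy
    with x₁ , x₂ , k , eq₁ , eq₂ ← lift-edge j
    with Equivalence.to (onV-kernel x x₁) (trans eqx (sym eq₁))
  ... | inj₁ refl with W′ , le , over ← lift W (unique-tail u) eq₂ eqy =
    step x (onE e) k W′ , s≤s le , over-step {j = j} {k = k} W W′ eq₁ over
  -- The walk leaves `c` from the other end of the contracted edge, which is inserted here; the rest
  -- avoids `c` and needs no further edge.
  ... | inj₂ l
    with refl ← trans (sym eqx) (contracted-end l)
    with W′ , eq , over ← lift-avoiding W (unique-head u) eq₂ eqy =
    step x contracted l (step x₁ (onE e) k W′) , s≤s (s≤s (≤-reflexive eq))
    , λ { (here refl) → here eqx ; (there z∈) → over-step {j = j} {k = k} W W′ eq₁ over z∈ }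

  -- Preimages of vertex sets under a contraction.

  section : V G → V H
  section a = proj₁ (onV-surj a)

  onV-section : ∀ a → onV (section a) ≡ a
  onV-section a = proj₂ (onV-surj a) refl

  section-injective : Injective _≡_ _≡_ section
  section-injective {a} {b} eq = trans (sym (onV-section a)) (trans (cong onV eq) (onV-section b))

  -- Both `p` and `q` lie over `c`, and they differ because `H` is loopless, so one of them is not
  -- the chosen preimage.
  off-section : ∃[ o ] onV o ≡ c × o ≢ section c
  off-section with section c ≟ p
  ... | yes eq = q , onV-q , λ q≡ → joins-≢ {H} p~q (trans (sym eq) (sym q≡))
  ... | no neq = p , refl , neq ∘ sym

  preimage : List (V G) → List (V H)
  preimage X = filter (λ x → onV x ∈? X) (allFin (order H))

  unique-preimage : ∀ X → Unique (preimage X)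
  unique-preimage X = Unique.filter⁺ (λ x → onV x ∈? X) (Unique.allFin⁺ (order H))

  ∈-preimage⁺ : ∀ {X x} → onV x ∈ X → x ∈ preimage X
  ∈-preimage⁺ {X} = ∈-filter⁺ (λ x → onV x ∈? X) (∈-allFin _)

  ∈-preimage⁻ : ∀ {X x} → x ∈ preimage X → onV x ∈ X
  ∈-preimage⁻ {X} = proj₂ ∘ ∈-filter⁻ (λ x → onV x ∈? X) {xs = allFin (order H)}

  map-section-⊆ : ∀ X → map section X ⊆ preimage X
  map-section-⊆ X x∈ with a , a∈ , refl ← ∈-map⁻ section x∈ =
    ∈-preimage⁺ (subst (_∈ X) (sym (onV-section a)) a∈)

  length-preimage : ∀ {X} → Unique X → length X ≤ length (preimage X)
  length-preimage {X} u = subst (_≤ length (preimage X)) (length-map section X)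
    (unique-⊆⇒length≤ (Unique.map⁺ section-injective u) (map-section-⊆ X))

  -- Besides the chosen preimages of the members there is a second vertex over `c`. This gain of one
  -- pays for the larger radius.
  length-preimage-∋ : ∀ {X} → Unique X → c ∈ X → suc (length X) ≤ length (preimage X)
  length-preimage-∋ {X} u c∈ with o , onV-o , o≢ ← off-section =
    subst (λ l → suc l ≤ length (preimage X)) (length-map section X)
      (unique-⊆⇒length≤ (unique-∷ o∉ (Unique.map⁺ section-injective u)) sub)
    where
    o∉ : o ∉ map section X
    o∉ o∈ with a , _ , refl ← ∈-map⁻ section o∈ =
      o≢ (cong section (trans (sym (onV-section a)) onV-o))

    sub : o ∷ map section X ⊆ preimage X
    sub (here refl) = ∈-preimage⁺ (subst (_∈ X) (sym onV-o) c∈)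
    sub (there x∈)  = map-section-⊆ X x∈

  -- The step shared by the cases `c ∈ X` and `c ∉ X`, which take `D′` as `suc D` and as `D`.
  -- Erasing loops from a lifted walk keeps it over `X`.
  linked-preimage : ∀ {X D D′} → Linked {G} X D →
    (∀ {x y} (P : Path G (onV x) (onV y)) → #edges P ≤ D → pathVertices P ⊆ X →
      Σ (Walk H x y) λ W → len W ≤ D′ × Over (walk P) W) →
    Linked {H} (preimage X) D′
  linked-preimage {X} linked lift′ x∈ y∈
    with P , P≤ , P⊆ ← linked (∈-preimage⁻ {X} x∈) (∈-preimage⁻ {X} y∈)
    with W , W≤ , over ← lift′ P P≤ P⊆
    with Q , I ← walk⇒path W =
    Q , ≤-trans (len-≤ I) W≤ , ∈-preimage⁺ ∘ P⊆ ∘ over ∘ vertices-⊆ I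

  -- If `c` is a member, the radius grows by one and the number of members by at least one.
  -- Otherwise the linking paths avoid `c` and lift with their lengths unchanged.
  lift-cluster : ∀ {n d} → Cluster n d G → Cluster n d H
  lift-cluster {n} {d} K with c ∈? Cluster.members K
  ... | yes c∈ = record
    { members = preimage members
    ; unique  = unique-preimage members
    ; radius  = suc radius
    ; linked  = linked-preimage linked λ P P≤ P⊆ →
        let W , W≤ , over = lift (walk P) (simple P) refl refl in W , ≤-trans W≤ (s≤s P≤) , over
    ; excess  = ≤-trans (≤-reflexive (+-suc n radius))
                  (≤-trans (s≤s excess) (+-monoˡ-≤ d (length-preimage-∋ unique c∈)))
    }
    where open Cluster K
  ... | no c∉ = record
    { members = preimage members
    ; unique  = unique-preimage members
    ; radius  = radius
    ; linked  = linked-preimage linked λ P P≤ P⊆ →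
        let W , eq , over = lift-avoiding (walk P) (c∉ ∘ P⊆) refl refl
        in W , ≤-trans (≤-reflexive eq) P≤ , over
    ; excess  = ≤-trans excess (+-monoˡ-≤ d (length-preimage unique))
    }
    where open Cluster K

-- The lower bound through minors and the value at the tree.

minor-step-cluster : ∀ {n d H G} → MinorStep H G → Cluster n d G → Cluster n d H
minor-step-cluster (inj₁ D)        = _↪_.map-cluster (vertexDeletion⇒↪ D)
minor-step-cluster (inj₂ (inj₁ D)) = _↪_.map-cluster (edgeDeletion⇒↪ D)
minor-step-cluster (inj₂ (inj₂ C)) = lift-cluster C

minor-cluster : ∀ {n d H G} → G IsMinorOf H → Cluster n d G → Cluster n d H
minor-cluster {n} {d} (_ , steps , iso) = along steps ∘ _↪_.map-cluster (≅⇒↪ iso)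
  where
  along : ∀ {H K} → Star MinorStep H K → Cluster n d K → Cluster n d H
  along ε        = id
  along (s ◅ ss) = minor-step-cluster s ∘ along ss

diameter-cluster : ∀ {G d} → IsDiameter G d → Cluster (order G) d G
diameter-cluster {G} {d} (_ , bound) = record
  { members = allFin (order G)
  ; unique  = Unique.allFin⁺ (order G)
  ; radius  = d
  ; linked  = λ {x} {y} _ _ → let _ , (P , _ , eq) , ≤d = bound x y
                              in P , ≤-trans (≤-reflexive eq) ≤d , λ {z} _ → ∈-allFin z
  ; excess  = ≤-reflexive (cong (_+ d) (sym (length-allFin (order G))))
  }

-- `linked-bound` is applied to a path `P` attaining the parade number `k`, for which `s` is
-- `order H ∸ k`.
cluster⇒spectators : ∀ {n d H s} → Cluster n d H → IsSpectatorNumber H s → n ∸ suc d ≤ s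
cluster⇒spectators {n} {d} {H} K (_ , ((_ , _ , P , (short , _) , refl) , _) , refl) =
  m≤n+o⇒m∸n≤o n (suc d) (+-cancelʳ-≤ k _ _ bound)
  where
  open Cluster K
  open ≤-Reasoning
  k = #vertices P

  k≤ : k ≤ order H
  k≤ = unique⇒length≤ (simple P)

  swap-last : ∀ x y z → x + y + z ≡ x + z + y
  swap-last = solve-∀

  regroup : ∀ x y z → x + y + z ≡ y + (x + z)
  regroup = solve-∀

  shift-suc : ∀ x y z → x + (suc y + z) ≡ suc x + z + y
  shift-suc = solve-∀

  -- Adding `k` undoes the truncated subtraction, as `k ≤ order H`. Adding `radius` makes `excess`
  -- applicable, and the copy produced by `linked-bound` lets it cancel.
  bound : n + k ≤ suc d + (order H ∸ k) + k
  bound = +-cancelʳ-≤ radius _ _ (begin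
    n + k + radius                        ≡⟨ swap-last n k radius ⟩
    n + radius + k                        ≤⟨ +-monoˡ-≤ k excess ⟩
    length members + d + k                ≡⟨ regroup (length members) d k ⟩
    d + (length members + k)              ≤⟨ +-monoʳ-≤ d (linked-bound unique linked P short) ⟩
    d + (suc radius + order H)            ≡⟨ shift-suc d radius (order H) ⟩
    suc d + order H + radius              ≡⟨ cong (λ m → suc d + m + radius) (m∸n+n≡m k≤) ⟨
    suc d + (order H ∸ k + k) + radius    ≡⟨ cong (_+ radius) (+-assoc (suc d) _ k) ⟨
    suc d + (order H ∸ k) + k + radius    ∎)

-- A path realising the diameter is unique because paths in a tree are determined by their ends, and
-- no shortest path has more than `d` edges, hence more than `suc d` vertices.
tree-parade : ∀ {T d} → IsTree T → IsDiameter T d → IsParadeNumber T (suc d)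
tree-parade {T} (_ , acyclic) ((u , v , P , short , refl) , bound) =
  (u , v , P , (short , unique) , length-vertices (walk P)) , λ x y Q (shortQ , _) →
    let _ , (R , _ , eq) , ≤d = bound x y
    in ≤-trans (≤-reflexive (length-vertices (walk Q)))
               (s≤s (≤-trans (shortQ R) (≤-trans (≤-reflexive eq) ≤d)))
  where
  unique : ∀ Q → #vertices Q ≡ #vertices P → pathEdges Q ≡ pathEdges P
  unique Q _ = acyclic⇒edges-unique acyclic (walk Q) (walk P) (simple Q) (simple P)

theorem4p2 : ∀ (T : Graph) → IsTree T → ∀ (d : ℕ) → IsDiameter T d →
    IsSpectatorFloor T (order T ∸ d ∸ 1)
theorem4p2 T tree d diam =
  -- `T` is a minor of itself by the empty sequence of steps.
  (T , (T , ε , ≅-refl) , suc d , tree-parade tree diam , shift) ,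
  λ H s minor spectators → subst (_≤ s) (sym shift)
    (cluster⇒spectators (minor-cluster minor (diameter-cluster diam)) spectators)
  where
  shift : order T ∸ d ∸ 1 ≡ order T ∸ suc d
  shift = trans (∸-+-assoc (order T) d 1) (cong (order T ∸_) (+-comm d 1))
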